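{- Let $H_1^{\le},\dots,H_r^{\le}\subseteq\mathbb{R}^n$ be affine halfspaces with boundary hyperplanes $H_1,\dots,H_r$, and let $\mathcal{R}\subseteq\mathbb{R}^n\times\mathbb{R}^n$ be the polyhedral relation induced by the sequence $(R_{H_1^{\le}},\dots,R_{H_r^{\le}})$ of reflection relations. Let $P,Q\subseteq\mathbb{R}^n$ be polytopes with $Q=\operatorname{conv}(W)$ for some $W\subseteq\mathbb{R}^n$. Suppose that the following two conditions hold: (1) $P\subseteq Q$ and $\varrho^{(H_i)}(Q)\subseteq Q$ for all $i\in\{1,\dots,r\}$; (2) $\varrho^{\star(H_1^{\le})}\circ\cdots\circ\varrho^{\star(H_r^{\le})}(w)\in P$ for all $w\in W$. Then $Q=\mathcal{R}(P)$.
   Context: For $a\in\mathbb{R}^n\setminus\{0\}$ and $\beta\in\mathbb{R}$ let $H=\{x\in\mathbb{R}^n:\langle a,x\rangle=\beta\}$ and $H^{\le}=\{x\in\mathbb{R}^n:\langle a,x\rangle\le\beta\}$, and let $H^{\perp}=\{\lambda a:\lambda\in\mathbb{R}\}$. The map $\varrho^{(H)}:\mathbb{R}^n\to\mathbb{R}^n$ is the orthogonal reflection at $H$: $\varrho^{(H)}(x)-x\in H^\perp$ and $\langle a,\varrho^{(H)}(x)\rangle=2\beta-\langle a,x\rangle$. The reflection relation defined by $H^{\le}$ is $$R_{H^{\le}}=\{(x,y)\in\mathbb{R}^n\times\mathbb{R}^n: y-x\in H^{\perp},\ \langle a,x\rangle\le\langle a,y\rangle\le 2\beta-\langle a,x\rangle\}$$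 (independent of positive rescaling of $(a,\beta)$). The map $\varrho^{\star(H^{\le})}:\mathbb{R}^n\to\mathbb{R}^n$ is defined by $\varrho^{\star(H^{\le})}(y)=y$ if $y\in H^{\le}$ and $\varrho^{\star(H^{\le})}(y)=\varrho^{(H)}(y)$ otherwise. The relation induced by a sequence $(R_1,\dots,R_r)$ of polyhedra $R_i\subseteq\mathbb{R}^n\times\mathbb{R}^n$ is the set $\mathcal{R}$ of all $(z^{(0)},z^{(r)})\in\mathbb{R}^n\times\mathbb{R}^n$ for which there are $z^{(1)},\dots,z^{(r-1)}\in\mathbb{R}^n$ with $(z^{(i-1)},z^{(i)})\in R_i$ for all $i\in\{1,\dots,r\}$. For a relation $R\subseteq\mathbb{R}^n\times\mathbb{R}^n$ and $X\subseteq\mathbb{R}^n$, $R(X)=\{y\in\mathbb{R}^n:(x,y)\in R\text{ for some }x\in X\}$. -}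

module Defs where

open import Algebra.Bundles using (CommutativeRing)
import Algebra.Definitions as AlgebraicDefinitions
import Algebra.Definitions.RawMonoid as RawSum
import Algebra.Properties.Ring as RingProperties
import Algebra.Properties.Semiring.Sum as SemiringSum
open import Data.Fin.Base using (Fin; zero; suc; inject₁; fromℕ)
open import Data.Nat.Base using (ℕ; zero; suc)
open import Data.Product.Base using (Σ-syntax; ∃; ∃-syntax; _×_; _,_; proj₁; proj₂)
open import Data.Sum.Base using (inj₁; inj₂)
open import Data.Vec.Functional using (Vector; foldr; map; zipWith; replicate)
import Data.Vec.Functional.Relation.Binary.Equality.Setoid as VecEq
open import Function.Base using (_∘_; id)
open import Level using (0ℓ)
open import Relation.Binary.Core using (Rel)
import Relation.Binary.Reasoning.Setoid as SetoidReasoning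
open import Relation.Binary.Structures using (IsDecTotalOrder)
open import Relation.Nullary using (¬_; yes; no)
open import Relation.Unary using (Pred; _∈_; _⊆_; _≐_; Satisfiable; Decidable)

-- The real numbers, given by their classical axiomatisation as a Dedekind
-- complete ordered field, which determines them up to isomorphism.  The
-- decidability of the order is the classical trichotomy; it is what makes
-- definitions by cases on membership in a halfspace total functions.
record RealField : Set₁ where
  infix 4 _≤_
  field
    commutativeRing : CommutativeRing 0ℓ 0ℓ

  open CommutativeRing commutativeRing public
  open AlgebraicDefinitions _≈_ using (Invertible)

  field
    0≉1             : 0# ≉ 1#
    ≉0⇒invertible   : ∀ {x} → x ≉ 0# → Invertible 1# _*_ x
    _≤_             : Rel Carrier 0ℓ
    isDecTotalOrder : IsDecTotalOrder _≈_ _≤_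
    +-monoˡ-≤       : ∀ {x y} z → x ≤ y → x + z ≤ y + z
    *-nonneg        : ∀ {x y} → 0# ≤ x → 0# ≤ y → 0# ≤ x * y

  UpperBound : Pred Carrier 0ℓ → Pred Carrier 0ℓ
  UpperBound S b = ∀ {x} → x ∈ S → x ≤ b

  field
    supremum : (S : Pred Carrier 0ℓ) → Satisfiable S → Satisfiable (UpperBound S) →
               ∃[ s ] s ∈ UpperBound S × (∀ {b} → b ∈ UpperBound S → s ≤ b)

  module Order = IsDecTotalOrder isDecTotalOrder

module Euclidean (𝓡 : RealField) where

  open RealField 𝓡 renaming (Carrier to ℝ) hiding (zero)
  open RawSum +-rawMonoid using (sum)
  open VecEq setoid using (_≋_) public

  -- ℝⁿ is a setoid under the coordinatewise equality _≋_.  A Subset is a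
  -- predicate that need not respect _≋_, and stands for its closure under _≋_;
  -- convex hulls and images are built to respect _≋_.
  Point : ℕ → Set
  Point n = Vector ℝ n

  Subset : ℕ → Set₁
  Subset n = Pred (Point n) 0ℓ

  Relation : ℕ → Set₁
  Relation n = Rel (Point n) 0ℓ

  infixl 6 _⊕_ _⊖_
  infixr 7 _•_

  0ᵛ : ∀ {n} → Point n
  0ᵛ = replicate _ 0#

  _⊕_ _⊖_ : ∀ {n} → Point n → Point n → Point n
  _⊕_ = zipWith _+_
  _⊖_ = zipWith _-_

  _•_ : ∀ {n} → ℝ → Point n → Point n
  t • x = map (t *_) x

  ⟨_,_⟩ : ∀ {n} → Point n → Point n → ℝ
  ⟨ x , y ⟩ = sum (zipWith _*_ x y)

  sumᵛ : ∀ {n k} → Vector (Point n) k → Point n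
  sumᵛ = foldr _⊕_ 0ᵛ

  conv : ∀ {n} → Subset n → Subset n
  conv {n} W x =
    ∃[ k ] Σ[ w ∈ Vector (Point n) k ] Σ[ c ∈ Vector ℝ k ]
      (∀ i → w i ∈ W) × (∀ i → 0# ≤ c i) × sum c ≈ 1# × x ≋ sumᵛ (zipWith _•_ c w)

  range : ∀ {n k} → Vector (Point n) k → Subset n
  range v x = ∃[ i ] x ≋ v i

  IsPolytope : ∀ {n} → Pred (Subset n) 0ℓ
  IsPolytope {n} P = ∃[ k ] Σ[ v ∈ Vector (Point n) k ] P ≐ conv (range v)

  image : ∀ {n} → (Point n → Point n) → Subset n → Subset n
  image f X y = ∃[ x ] x ∈ X × y ≋ f x

  infix 8 _⟦_⟧
  _⟦_⟧ : ∀ {n} → Relation n → Subset n → Subset n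
  (R ⟦ X ⟧) y = ∃[ x ] x ∈ X × R x y

  Induced : ∀ {n r} → Vector (Relation n) r → Relation n
  Induced {n} {r} R x y =
    Σ[ z ∈ Vector (Point n) (suc r) ]
      x ≋ z zero × y ≋ z (fromℕ r) × (∀ i → R i (z (inject₁ i)) (z (suc i)))

  -- A closed halfspace together with a choice of defining inequality
  -- ⟨ normal , x ⟩ ≤ offset.
  record Halfspace (n : ℕ) : Set where
    field
      normal   : Point n
      offset   : ℝ
      normal≢0 : ¬ normal ≋ 0ᵛ

  open Halfspace

  infix 9 _^≤ _^≤? _^⊥
  _^≤ : ∀ {n} → Halfspace n → Subset n
  (H ^≤) x = ⟨ normal H , x ⟩ ≤ offset H

  _^≤? : ∀ {n} (H : Halfspace n) → Decidable (H ^≤)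
  (H ^≤?) x = ⟨ normal H , x ⟩ Order.≤? offset H

  _^⊥ : ∀ {n} → Halfspace n → Subset n
  (H ^⊥) x = ∃[ t ] x ≋ t • normal H

  open RingProperties ring using (-‿distribˡ-*; -‿distribʳ-*; -‿involutive)

  ≤-cong : ∀ {x x′ y y′} → x ≈ x′ → y ≈ y′ → x ≤ y → x′ ≤ y′
  ≤-cong x≈x′ y≈y′ = Order.≤-respˡ-≈ x≈x′ ∘ Order.≤-respʳ-≈ y≈y′

  square-nonneg : ∀ x → 0# ≤ x * x
  square-nonneg x with Order.total 0# x
  ... | inj₁ 0≤x = *-nonneg 0≤x 0≤x
  ... | inj₂ x≤0 = Order.≤-respʳ-≈ neg*neg (*-nonneg 0≤-x 0≤-x)
    where
    0≤-x : 0# ≤ - x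
    0≤-x = ≤-cong (-‿inverseʳ x) (+-identityˡ (- x)) (+-monoˡ-≤ (- x) x≤0)
    neg*neg : - x * - x ≈ x * x
    neg*neg = trans (sym (-‿distribˡ-* x (- x)))
             (trans (-‿cong (sym (-‿distribʳ-* x x))) (-‿involutive (x * x)))

  x≤x+y : ∀ x {y} → 0# ≤ y → x ≤ x + y
  x≤x+y x {y} 0≤y = ≤-cong (+-identityˡ x) (+-comm y x) (+-monoˡ-≤ x 0≤y)

  sum-squares-nonneg : ∀ {n} (a : Point n) → 0# ≤ ⟨ a , a ⟩
  sum-squares-nonneg {zero}  a = Order.refl
  sum-squares-nonneg {suc n} a =
    Order.trans (square-nonneg (a zero))
                (x≤x+y (a zero * a zero) (sum-squares-nonneg (a ∘ suc)))

  square≈0 : ∀ x → x * x ≈ 0# → x ≈ 0#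
  square≈0 x x²≈0 with x Order.≟ 0#
  ... | yes x≈0 = x≈0
  ... | no  x≉0 with ≉0⇒invertible x≉0
  ...   | y , yx≈1 , _ = begin
    x            ≈⟨ *-identityˡ x ⟨
    1# * x       ≈⟨ *-congʳ yx≈1 ⟨
    (y * x) * x  ≈⟨ *-assoc y x x ⟩
    y * (x * x)  ≈⟨ *-congˡ x²≈0 ⟩
    y * 0#       ≈⟨ zeroʳ y ⟩
    0#           ∎
    where open SetoidReasoning setoid

  inner-definite : ∀ {n} (a : Point n) → ⟨ a , a ⟩ ≈ 0# → a ≋ 0ᵛ
  inner-definite {suc n} a aa≈0 = λ where
      zero    → square≈0 (a zero) s≈0
      (suc i) → inner-definite (a ∘ suc) t≈0 i
    where
    s = a zero * a zero
    t = ⟨ a ∘ suc , a ∘ suc ⟩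
    0≤t = sum-squares-nonneg (a ∘ suc)
    s≈0 : s ≈ 0#
    s≈0 = Order.antisym (Order.≤-respʳ-≈ aa≈0 (x≤x+y s 0≤t)) (square-nonneg (a zero))
    t≈0 : t ≈ 0#
    t≈0 = trans (sym (+-identityˡ t)) (trans (+-congʳ (sym s≈0)) aa≈0)

  normSq≉0 : ∀ {n} (H : Halfspace n) → ⟨ normal H , normal H ⟩ ≉ 0#
  normSq≉0 H = normal≢0 H ∘ inner-definite (normal H)

  normSq⁻¹ : ∀ {n} → Halfspace n → ℝ
  normSq⁻¹ H = proj₁ (≉0⇒invertible (normSq≉0 H))

  normSq⁻¹-inverseˡ : ∀ {n} (H : Halfspace n) → normSq⁻¹ H * ⟨ normal H , normal H ⟩ ≈ 1#
  normSq⁻¹-inverseˡ H = proj₁ (proj₂ (≉0⇒invertible (normSq≉0 H)))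

  -- The point of x + H^⊥ on which ⟨ normal H , _ ⟩ takes the value
  -- 2 offset H - ⟨ normal H , x ⟩; see ϱ-direction, ϱ-inner and ϱ-unique.
  ϱ : ∀ {n} → Halfspace n → Point n → Point n
  ϱ H x = x ⊕ (((β + β - ⟨ a , x ⟩) - ⟨ a , x ⟩) * normSq⁻¹ H) • a
    where
    a = normal H
    β = offset H

  ϱ⋆ : ∀ {n} → Halfspace n → Point n → Point n
  ϱ⋆ H y with (H ^≤?) y
  ... | yes _ = y
  ... | no  _ = ϱ H y

  compose : ∀ {n r} → Vector (Point n → Point n) r → Point n → Point n
  compose = foldr (λ f g → f ∘ g) id

  reflectionRelation : ∀ {n} → Halfspace n → Relation n
  reflectionRelation H x y =
    (y ⊖ x) ∈ H ^⊥ × ⟨ a , x ⟩ ≤ ⟨ a , y ⟩ × ⟨ a , y ⟩ ≤ β + β - ⟨ a , x ⟩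
    where
    a = normal H
    β = offset H

  open SemiringSum semiring using (sum-cong-≋; ∑-distrib-+; *-distribˡ-sum)

  inner-shift : ∀ {n} (a x : Point n) t → ⟨ a , x ⊕ t • a ⟩ ≈ ⟨ a , x ⟩ + t * ⟨ a , a ⟩
  inner-shift {n} a x t = begin
    ⟨ a , x ⊕ t • a ⟩                                 ≈⟨ sum-cong-≋ coord ⟩
    sum (λ i → a i * x i + t * (a i * a i))           ≈⟨ ∑-distrib-+ (zipWith _*_ a x) _ ⟩
    ⟨ a , x ⟩ + sum (λ i → t * (a i * a i))           ≈⟨ +-congˡ (*-distribˡ-sum t (zipWith _*_ a a)) ⟨
    ⟨ a , x ⟩ + t * ⟨ a , a ⟩                         ∎
    where
    open SetoidReasoning setoid
    coord : ∀ i → a i * (x i + t * a i) ≈ a i * x i + t * (a i * a i)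
    coord i = trans (distribˡ (a i) (x i) (t * a i)) (+-congˡ
      (trans (sym (*-assoc (a i) t (a i)))
      (trans (*-congʳ (*-comm (a i) t)) (*-assoc t (a i) (a i)))))

  x+[y-x]≈y : ∀ x y → x + (y - x) ≈ y
  x+[y-x]≈y x y = trans (+-comm x (y - x)) (trans (+-assoc y (- x) x)
                  (trans (+-congˡ (-‿inverseˡ x)) (+-identityʳ y)))

  [x+y]-x≈y : ∀ x y → (x + y) - x ≈ y
  [x+y]-x≈y x y = trans (+-assoc x y (- x)) (x+[y-x]≈y x y)

  ϱ-direction : ∀ {n} (H : Halfspace n) x → (ϱ H x ⊖ x) ∈ H ^⊥
  ϱ-direction H x = _ , λ i → [x+y]-x≈y (x i) _

  ϱ-inner : ∀ {n} (H : Halfspace n) x →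
            ⟨ normal H , ϱ H x ⟩ ≈ offset H + offset H - ⟨ normal H , x ⟩
  ϱ-inner H x = begin
    ⟨ a , ϱ H x ⟩                                       ≈⟨ inner-shift a x _ ⟩
    ⟨ a , x ⟩ + ((γ - ⟨ a , x ⟩) * ν) * ⟨ a , a ⟩       ≈⟨ +-congˡ (*-assoc _ ν _) ⟩
    ⟨ a , x ⟩ + (γ - ⟨ a , x ⟩) * (ν * ⟨ a , a ⟩)       ≈⟨ +-congˡ (*-congˡ (normSq⁻¹-inverseˡ H)) ⟩
    ⟨ a , x ⟩ + (γ - ⟨ a , x ⟩) * 1#                    ≈⟨ +-congˡ (*-identityʳ _) ⟩
    ⟨ a , x ⟩ + (γ - ⟨ a , x ⟩)                         ≈⟨ x+[y-x]≈y ⟨ a , x ⟩ γ ⟩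
    γ                                                   ∎
    where
    open SetoidReasoning setoid
    a = normal H
    γ = offset H + offset H - ⟨ a , x ⟩
    ν = normSq⁻¹ H

  ϱ-unique : ∀ {n} (H : Halfspace n) x y → (y ⊖ x) ∈ H ^⊥ →
             ⟨ normal H , y ⟩ ≈ offset H + offset H - ⟨ normal H , x ⟩ → y ≋ ϱ H x
  ϱ-unique H x y (t , y-x≋ta) ay≈γ i = trans (y≋x+ta i) (+-congˡ (*-congʳ t≈))
    where
    open SetoidReasoning setoid
    a = normal H
    γ = offset H + offset H - ⟨ a , x ⟩
    ν = normSq⁻¹ H
    N = ⟨ a , a ⟩
    y≋x+ta : y ≋ x ⊕ t • a
    y≋x+ta j = trans (sym (x+[y-x]≈y (x j) (y j))) (+-congˡ (y-x≋ta j))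
    γ≈ : γ ≈ ⟨ a , x ⟩ + t * N
    γ≈ = trans (sym ay≈γ) (trans (sum-cong-≋ (λ j → *-congˡ (y≋x+ta j))) (inner-shift a x t))
    t≈ : t ≈ (γ - ⟨ a , x ⟩) * ν
    t≈ = begin
      t                                 ≈⟨ *-identityʳ t ⟨
      t * 1#                            ≈⟨ *-congˡ (normSq⁻¹-inverseˡ H) ⟨
      t * (ν * N)                       ≈⟨ *-congˡ (*-comm ν N) ⟩
      t * (N * ν)                       ≈⟨ *-assoc t N ν ⟨
      (t * N) * ν                       ≈⟨ *-congʳ ([x+y]-x≈y ⟨ a , x ⟩ (t * N)) ⟨
      ((⟨ a , x ⟩ + t * N) - ⟨ a , x ⟩) * ν  ≈⟨ *-congʳ (+-congʳ γ≈) ⟨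
      (γ - ⟨ a , x ⟩) * ν               ∎

{-# OPTIONS --safe #-}
-- The induced relation R is convex, so R(P) is convex.  Since (ϱ⋆ H y , y) ∈ R_H
-- for all y, every w ∈ W is reached from ϱ⋆ H₁ (… (ϱ⋆ Hᵣ w)) ∈ P, whence
-- Q = conv W ⊆ R(P).  Conversely, R_H relates x only to points of the segment
-- from x to ϱ H x, which stays inside Q.
module Submission where

open import Defs
import Algebra.Properties.Ring as RingProperties
import Algebra.Properties.Semiring.Sum as SemiringSum
open import Data.Fin.Base using (Fin; zero; suc; inject₁; fromℕ)
open import Data.Nat.Base using (ℕ; zero; suc)
open import Data.Product.Base using (Σ-syntax; ∃-syntax; _×_; _,_; proj₁; proj₂)
open import Data.Sum.Base using (inj₁; inj₂)
open import Data.Vec.Functional using (Vector; []; _∷_; zipWith)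
open import Function.Base using (_∘_)
open import Relation.Binary.PropositionalEquality using (_≡_; cong)
import Relation.Binary.Reasoning.Setoid as SetoidReasoning
open import Relation.Nullary using (yes; no; contradiction)
open import Relation.Unary using (_∈_; _⊆_; _≐_)

module Reflections (𝓡 : RealField) where

  open RealField 𝓡 renaming (Carrier to ℝ) hiding (zero)
  open Euclidean 𝓡
  open Halfspace
  open RingProperties ring using (-‿distribˡ-*; -‿distribʳ-*; -‿+-comm; -‿involutive)
  open SemiringSum semiring
    using (sum; sum-cong-≋; ∑-distrib-+; *-distribˡ-sum; *-distribʳ-sum; ∑-comm)
  open SetoidReasoning setoid

  -- Order arithmetic in the field.

  0≤y-x : ∀ {x y} → x ≤ y → 0# ≤ y - x
  0≤y-x {x} x≤y = Order.≤-respˡ-≈ (-‿inverseʳ x) (+-monoˡ-≤ (- x) x≤y)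

  0≤y-x⇒x≤y : ∀ {x y} → 0# ≤ y - x → x ≤ y
  0≤y-x⇒x≤y {x} {y} 0≤y-x =
    Order.≤-respʳ-≈ (x+[y-x]≈y x y) (x≤x+y x 0≤y-x)

  *-distribˡ-- : ∀ x y z → x * (y - z) ≈ x * y - x * z
  *-distribˡ-- x y z = trans (distribˡ x y (- z)) (+-congˡ (sym (-‿distribʳ-* x z)))

  *-monoˡ-≤ : ∀ {c x y} → 0# ≤ c → x ≤ y → c * x ≤ c * y
  *-monoˡ-≤ 0≤c x≤y = 0≤y-x⇒x≤y
    (Order.≤-respʳ-≈ (*-distribˡ-- _ _ _) (*-nonneg 0≤c (0≤y-x x≤y)))

  +-mono-≤ : ∀ {x y u v} → x ≤ y → u ≤ v → x + u ≤ y + v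
  +-mono-≤ {y = y} {u} {v} x≤y u≤v = Order.trans (+-monoˡ-≤ u x≤y)
    (≤-cong (+-comm u y) (+-comm v y) (+-monoˡ-≤ y u≤v))

  0≤1 : 0# ≤ 1#
  0≤1 = Order.≤-respʳ-≈ (*-identityʳ 1#) (square-nonneg 1#)

  -- Since `y` equals `x * (y * y)`, it is a product of nonnegative factors.
  inverse-nonneg : ∀ {x y} → y * x ≈ 1# → 0# ≤ x → 0# ≤ y
  inverse-nonneg {x} {y} yx≈1 0≤x = Order.≤-respʳ-≈ eq (*-nonneg 0≤x (square-nonneg y))
    where
    eq : x * (y * y) ≈ y
    eq = trans (sym (*-assoc x y y))
        (trans (*-congʳ (trans (*-comm x y) yx≈1)) (*-identityˡ y))

  -- Turns a two-sided bound into the parameter of a point on a segment: `s` is the quotient of `u`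
  -- by `δ`. If `δ` vanishes, so does `u`, and `s` is set to `0#`.
  ratio : ∀ {u δ} → 0# ≤ u → u ≤ δ → ∃[ s ] 0# ≤ s × s ≤ 1# × u ≈ s * δ
  ratio {u} {δ} 0≤u u≤δ with δ Order.≟ 0#
  ... | yes δ≈0 = 0# , Order.refl , 0≤1 ,
                  trans (Order.antisym (Order.≤-respʳ-≈ δ≈0 u≤δ) 0≤u) (sym (zeroˡ δ))
  ... | no δ≉0 with ≉0⇒invertible δ≉0
  ...   | δ⁻¹ , δ⁻¹δ≈1 , _ = δ⁻¹ * u
        , *-nonneg 0≤δ⁻¹ 0≤u
        , Order.≤-respʳ-≈ δ⁻¹δ≈1 (*-monoˡ-≤ 0≤δ⁻¹ u≤δ)
        , sym (begin
            (δ⁻¹ * u) * δ  ≈⟨ *-congʳ (*-comm δ⁻¹ u) ⟩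
            (u * δ⁻¹) * δ  ≈⟨ *-assoc u δ⁻¹ δ ⟩
            u * (δ⁻¹ * δ)  ≈⟨ *-congˡ δ⁻¹δ≈1 ⟩
            u * 1#         ≈⟨ *-identityʳ u ⟩
            u              ∎)
    where 0≤δ⁻¹ = inverse-nonneg δ⁻¹δ≈1 (Order.trans 0≤u u≤δ)

  -- Inner products, also read as weighted sums with weights in the first argument.

  ⟨⟩-cong : ∀ {n} (a : Point n) {x y} → x ≋ y → ⟨ a , x ⟩ ≈ ⟨ a , y ⟩
  ⟨⟩-cong a x≋y = sum-cong-≋ (λ i → *-congˡ (x≋y i))

  ⟨⟩-comm : ∀ {n} (x y : Point n) → ⟨ x , y ⟩ ≈ ⟨ y , x ⟩
  ⟨⟩-comm x y = sum-cong-≋ (λ i → *-comm (x i) (y i))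

  -- Associativity of the product row vector `c`, matrix `d`, column vector `f`, by exchanging the
  -- two sums. It is the algebra behind combinations of combinations and behind linearity of the
  -- inner product.
  ⟨⟩-assoc : ∀ {k m} (c : Vector ℝ k) (d : Vector (Point m) k) (f : Point m) →
             ⟨ (λ j → ⟨ c , (λ i → d i j) ⟩) , f ⟩ ≈ ⟨ c , (λ i → ⟨ d i , f ⟩) ⟩
  ⟨⟩-assoc {k} {m} c d f = begin
    sum (λ j → sum (λ i → c i * d i j) * f j)    ≈⟨ sum-cong-≋ (λ j → *-distribʳ-sum (f j) (λ i → c i * d i j)) ⟩
    sum (λ j → sum (λ i → (c i * d i j) * f j))  ≈⟨ ∑-comm (λ j i → (c i * d i j) * f j) ⟩
    sum (λ i → sum (λ j → (c i * d i j) * f j))  ≈⟨ sum-cong-≋ (λ i → sum-cong-≋ (λ j → *-assoc (c i) (d i j) (f j))) ⟩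
    sum (λ i → sum (λ j → c i * (d i j * f j)))  ≈⟨ sum-cong-≋ (λ i → *-distribˡ-sum (c i) (λ j → d i j * f j)) ⟨
    sum (λ i → c i * sum (λ j → d i j * f j))    ∎

  ⟨⟩-scaleʳ : ∀ {k} (c f : Vector ℝ k) t → ⟨ c , (λ i → f i * t) ⟩ ≈ ⟨ c , f ⟩ * t
  ⟨⟩-scaleʳ c f t = trans (sum-cong-≋ (λ i → sym (*-assoc (c i) (f i) t)))
                          (sym (*-distribʳ-sum t (zipWith _*_ c f)))

  ⟨⟩-const : ∀ {k} (c : Vector ℝ k) → sum c ≈ 1# → ∀ t → ⟨ c , (λ _ → t) ⟩ ≈ t
  ⟨⟩-const c Σc≈1 t = trans (sym (*-distribʳ-sum t c)) (trans (*-congʳ Σc≈1) (*-identityˡ t))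

  ⟨⟩-⊖ : ∀ {k} (c f g : Vector ℝ k) → ⟨ c , f ⊖ g ⟩ ≈ ⟨ c , f ⟩ - ⟨ c , g ⟩
  ⟨⟩-⊖ c f g = begin
    -- Adding and subtracting `⟨ c , g ⟩` reduces the claim to additivity of sums.
    ⟨ c , f ⊖ g ⟩                            ≈⟨ [x+y]-x≈y ⟨ c , g ⟩ _ ⟨
    (⟨ c , g ⟩ + ⟨ c , f ⊖ g ⟩) - ⟨ c , g ⟩  ≈⟨ +-congʳ (∑-distrib-+ (zipWith _*_ c g) _) ⟨
    sum (λ i → c i * g i + c i * (f i - g i)) - ⟨ c , g ⟩
      ≈⟨ +-congʳ (sum-cong-≋ λ i → trans (sym (distribˡ (c i) (g i) _)) (*-congˡ (x+[y-x]≈y (g i) (f i)))) ⟩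
    ⟨ c , f ⟩ - ⟨ c , g ⟩                    ∎

  sum-mono-≤ : ∀ {k} {f g : Vector ℝ k} → (∀ i → f i ≤ g i) → sum f ≤ sum g
  sum-mono-≤ {zero}  f≤g = Order.refl
  sum-mono-≤ {suc k} f≤g = +-mono-≤ (f≤g zero) (sum-mono-≤ (f≤g ∘ suc))

  ⟨⟩-mono-≤ : ∀ {k} {c f g : Vector ℝ k} → (∀ i → 0# ≤ c i) → (∀ i → f i ≤ g i) →
              ⟨ c , f ⟩ ≤ ⟨ c , g ⟩
  ⟨⟩-mono-≤ 0≤c f≤g = sum-mono-≤ (λ i → *-monoˡ-≤ (0≤c i) (f≤g i))

  ⟨⟩-nonneg : ∀ {k} {c f : Vector ℝ k} → (∀ i → 0# ≤ c i) → (∀ i → 0# ≤ f i) →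
              0# ≤ ⟨ c , f ⟩
  ⟨⟩-nonneg {zero}  0≤c 0≤f = Order.refl
  ⟨⟩-nonneg {suc k} 0≤c 0≤f = Order.trans (*-nonneg (0≤c zero) (0≤f zero))
    (x≤x+y _ (⟨⟩-nonneg (0≤c ∘ suc) (0≤f ∘ suc)))

  -- The standard basis vectors, used as barycentric coordinates of the vertices.
  unit : ∀ {k} → Fin k → Vector ℝ k
  unit zero    = 1# ∷ λ _ → 0#
  unit (suc i) = 0# ∷ unit i

  unit-nonneg : ∀ {k} (i j : Fin k) → 0# ≤ unit i j
  unit-nonneg zero    zero    = 0≤1
  unit-nonneg zero    (suc j) = Order.refl
  unit-nonneg (suc i) zero    = Order.refl
  unit-nonneg (suc i) (suc j) = unit-nonneg i j

  ⟨unit⟩ : ∀ {k} (i : Fin k) (f : Vector ℝ k) → ⟨ unit i , f ⟩ ≈ f i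
  ⟨unit⟩ zero    f = trans (+-cong (*-identityˡ (f zero))
    (trans (sym (*-distribˡ-sum 0# (f ∘ suc))) (zeroˡ _))) (+-identityʳ _)
  ⟨unit⟩ (suc i) f = trans (+-cong (zeroˡ (f zero)) (⟨unit⟩ i (f ∘ suc))) (+-identityˡ _)

  sum≈⟨1⟩ : ∀ {k} (c : Vector ℝ k) → sum c ≈ ⟨ c , (λ _ → 1#) ⟩
  sum≈⟨1⟩ c = sum-cong-≋ (λ i → sym (*-identityʳ (c i)))

  -- Convex combinations, convex sets and polytopes.

  combination : ∀ {n k} → Vector ℝ k → Vector (Point n) k → Point n
  combination c w = sumᵛ (zipWith _•_ c w)

  -- Reduces statements about combinations of points to the weighted sums above, one coordinate at a
  -- time.
  combination-lookup : ∀ {n k} (c : Vector ℝ k) (w : Vector (Point n) k) →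
                       combination c w ≋ λ j → ⟨ c , (λ i → w i j) ⟩
  combination-lookup {k = zero}  c w j = refl
  combination-lookup {k = suc k} c w j = +-congˡ (combination-lookup (c ∘ suc) (w ∘ suc) j)

  combination-cong : ∀ {n k} (c : Vector ℝ k) {v w : Vector (Point n) k} →
                     (∀ i → v i ≋ w i) → combination c v ≋ combination c w
  combination-cong c {v} {w} v≋w j = trans (combination-lookup c v j)
    (trans (⟨⟩-cong c (λ i → v≋w i j)) (sym (combination-lookup c w j)))

  inner-combination : ∀ {n k} (a : Point n) (c : Vector ℝ k) (w : Vector (Point n) k) →
                      ⟨ a , combination c w ⟩ ≈ ⟨ c , (λ i → ⟨ a , w i ⟩) ⟩
  inner-combination a c w = begin
    ⟨ a , combination c w ⟩                    ≈⟨ ⟨⟩-cong a (combination-lookup c w) ⟩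
    ⟨ a , (λ j → ⟨ c , (λ i → w i j) ⟩) ⟩      ≈⟨ ⟨⟩-comm a _ ⟩
    ⟨ (λ j → ⟨ c , (λ i → w i j) ⟩) , a ⟩      ≈⟨ ⟨⟩-assoc c w a ⟩
    ⟨ c , (λ i → ⟨ w i , a ⟩) ⟩                ≈⟨ ⟨⟩-cong c (λ i → ⟨⟩-comm (w i) a) ⟩
    ⟨ c , (λ i → ⟨ a , w i ⟩) ⟩                ∎

  -- Contains closure under _≋_ as the case of a single point.
  IsConvex : ∀ {n} → Subset n → Set
  IsConvex X = conv X ⊆ X

  -- Convexity as a subset of the product space: pairs are combined componentwise with common
  -- weights, in any finite number to match `conv`.
  IsConvexRelation : ∀ {n} → Relation n → Set
  IsConvexRelation {n} R = ∀ {k} (c : Vector ℝ k) (x y : Vector (Point n) k) →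
    (∀ i → 0# ≤ c i) → sum c ≈ 1# → (∀ i → R (x i) (y i)) →
    R (combination c x) (combination c y)

  conv-mono : ∀ {n} {X Y : Subset n} → X ⊆ Y → ∀ {x} → x ∈ conv X → x ∈ conv Y
  conv-mono X⊆Y (k , w , c , w∈X , rest) = k , w , c , (λ i → X⊆Y (w∈X i)) , rest

  convex-resp-≋ : ∀ {n} {X : Subset n} → IsConvex X → ∀ {x y} → x ∈ X → y ≋ x → y ∈ X
  convex-resp-≋ convex {x} x∈X y≋x = convex
    ( 1 , (λ _ → x) , (λ _ → 1#) , (λ _ → x∈X) , (λ _ → 0≤1) , +-identityʳ 1#
    , λ j → trans (y≋x j) (sym (trans (+-identityʳ _) (*-identityˡ _))))

  -- The endpoints are `x` and `x ⊕ z`, with weights `1# - s` and `s`. Giving the second one by its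
  -- displacement fits the shape of `ϱ H x`.
  segment : ∀ {n} {X : Subset n} → IsConvex X → ∀ {x y z s} → x ∈ X → x ⊕ z ∈ X →
            0# ≤ s → s ≤ 1# → y ≋ x ⊕ s • z → y ∈ X
  segment convex {x} {y} {z} {s} x∈X x+z∈X 0≤s s≤1 y≋ = convex
    ( 2 , x ∷ (x ⊕ z) ∷ [] , 1# - s ∷ s ∷ []
    , (λ { zero → x∈X ; (suc zero) → x+z∈X })
    , (λ { zero → 0≤y-x s≤1 ; (suc zero) → 0≤s })
    , trans (+-congˡ (+-identityʳ s)) (trans (+-comm _ s) (x+[y-x]≈y s 1#))
    , λ j → trans (y≋ j) (sym (coordinate (x j) (z j))))
    where
    coordinate : ∀ p q → (1# - s) * p + (s * (p + q) + 0#) ≈ p + s * q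
    coordinate p q = begin
      (1# - s) * p + (s * (p + q) + 0#)    ≈⟨ +-congˡ (trans (+-identityʳ _) (distribˡ s p q)) ⟩
      (1# - s) * p + (s * p + s * q)       ≈⟨ +-assoc _ _ _ ⟨
      ((1# - s) * p + s * p) + s * q       ≈⟨ +-congʳ (distribʳ p (1# - s) s) ⟨
      ((1# - s) + s) * p + s * q           ≈⟨ +-congʳ (*-congʳ (trans (+-comm _ s) (x+[y-x]≈y s 1#))) ⟩
      1# * p + s * q                       ≈⟨ +-congʳ (*-identityˡ p) ⟩
      p + s * q                            ∎

  -- Unlike in conv (range v), every vertex occurs exactly once, so that
  -- combinations of combinations need no reindexing.
  Barycentric : ∀ {n m} → Vector (Point n) m → Subset n
  Barycentric {m = m} v x =
    Σ[ c ∈ Vector ℝ m ] (∀ i → 0# ≤ c i) × sum c ≈ 1# × x ≋ combination c v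

  range⊆Barycentric : ∀ {n m} (v : Vector (Point n) m) → range v ⊆ Barycentric v
  range⊆Barycentric v (i , x≋vi) =
    unit i , unit-nonneg i , trans (sum≈⟨1⟩ (unit i)) (⟨unit⟩ i _) ,
    λ j → trans (x≋vi j) (sym (trans (combination-lookup (unit i) v j) (⟨unit⟩ i _)))

  -- If the points have coordinate rows `d i`, their combination has coordinates `e`, the row `c`
  -- times the matrix `d`. Applying `⟨⟩-assoc` to the constant vector `1#` gives total weight one;
  -- applying it to the coordinates of the vertices gives the point itself.
  Barycentric-convex : ∀ {n m} (v : Vector (Point n) m) → IsConvex (Barycentric v)
  Barycentric-convex v {x} (k , w , c , w∈B , 0≤c , Σc≈1 , x≋) =
    e , (λ j → ⟨⟩-nonneg 0≤c (λ i → 0≤d i j)) , Σe≈1 , x≋e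
    where
    d = λ i → proj₁ (w∈B i)
    0≤d = λ i → proj₁ (proj₂ (w∈B i))
    Σd≈1 = λ i → proj₁ (proj₂ (proj₂ (w∈B i)))
    w≋ = λ i → proj₂ (proj₂ (proj₂ (w∈B i)))
    e = λ j → ⟨ c , (λ i → d i j) ⟩
    Σe≈1 : sum e ≈ 1#
    Σe≈1 = begin
      sum e                               ≈⟨ sum≈⟨1⟩ e ⟩
      ⟨ e , (λ _ → 1#) ⟩                  ≈⟨ ⟨⟩-assoc c d (λ _ → 1#) ⟩
      ⟨ c , (λ i → ⟨ d i , (λ _ → 1#) ⟩) ⟩  ≈⟨ ⟨⟩-cong c (λ i → trans (sym (sum≈⟨1⟩ (d i))) (Σd≈1 i)) ⟩
      ⟨ c , (λ _ → 1#) ⟩                  ≈⟨ ⟨⟩-const c Σc≈1 1# ⟩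
      1#                                  ∎
    x≋e : x ≋ combination e v
    x≋e j = begin
      x j                                       ≈⟨ x≋ j ⟩
      combination c w j                         ≈⟨ combination-cong c w≋ j ⟩
      combination c (λ i → combination (d i) v) j  ≈⟨ combination-lookup c _ j ⟩
      ⟨ c , (λ i → combination (d i) v j) ⟩     ≈⟨ ⟨⟩-cong c (λ i → combination-lookup (d i) v j) ⟩
      ⟨ c , (λ i → ⟨ d i , (λ l → v l j) ⟩) ⟩   ≈⟨ ⟨⟩-assoc c d (λ l → v l j) ⟨
      ⟨ e , (λ l → v l j) ⟩                     ≈⟨ combination-lookup e v j ⟨
      combination e v j                         ∎

  -- Members of `P` have barycentric coordinates, these can be combined, and the result is a
  -- combination of the vertices, hence again in `P`.
  polytope-convex : ∀ {n} {P : Subset n} → IsPolytope P → IsConvex P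
  polytope-convex {P = P} (m , v , P⊆ , ⊆P) x∈convP
    with Barycentric-convex v (conv-mono {X = P} P⊆Barycentric x∈convP)
    where
    P⊆Barycentric : P ⊆ Barycentric v
    P⊆Barycentric p∈P = Barycentric-convex v (conv-mono {X = range v} (range⊆Barycentric v) (P⊆ p∈P))
  ... | c , 0≤c , Σc≈1 , x≋ = ⊆P (m , v , c , (λ i → i , λ _ → refl) , 0≤c , Σc≈1 , x≋)

  -- Convexity of reflection relations and of images under induced relations.

  -- The defining conditions are affine in both points and the multiplier of the normal: multipliers
  -- average to `⟨ c , t ⟩`, nonnegative weights preserve inequalities, and total weight one
  -- preserves the constant `β+β`.
  reflectionRelation-convex : ∀ {n} (H : Halfspace n) → IsConvexRelation (reflectionRelation H)
  reflectionRelation-convex H c x y 0≤c Σc≈1 xRy =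
    (⟨ c , t ⟩ , difference) ,
    ≤-cong (sym (inner-combination a c x)) (sym (inner-combination a c y))
           (⟨⟩-mono-≤ 0≤c (λ i → proj₁ (proj₂ (xRy i)))) ,
    ≤-cong (sym (inner-combination a c y)) reflected
           (⟨⟩-mono-≤ 0≤c (λ i → proj₂ (proj₂ (xRy i))))
    where
    a = normal H
    β+β = offset H + offset H
    t = λ i → proj₁ (proj₁ (xRy i))
    difference : combination c y ⊖ combination c x ≋ ⟨ c , t ⟩ • a
    difference j = begin
      combination c y j - combination c x j
        ≈⟨ +-cong (combination-lookup c y j) (-‿cong (combination-lookup c x j)) ⟩
      ⟨ c , (λ i → y i j) ⟩ - ⟨ c , (λ i → x i j) ⟩
        ≈⟨ ⟨⟩-⊖ c (λ i → y i j) (λ i → x i j) ⟨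
      ⟨ c , (λ i → y i j - x i j) ⟩
        ≈⟨ ⟨⟩-cong c (λ i → proj₂ (proj₁ (xRy i)) j) ⟩
      ⟨ c , (λ i → t i * a j) ⟩
        ≈⟨ ⟨⟩-scaleʳ c t (a j) ⟩
      ⟨ c , t ⟩ * a j  ∎
    reflected : ⟨ c , (λ i → β+β - ⟨ a , x i ⟩) ⟩ ≈ β+β - ⟨ a , combination c x ⟩
    reflected = trans (⟨⟩-⊖ c (λ _ → β+β) (λ i → ⟨ a , x i ⟩))
      (+-cong (⟨⟩-const c Σc≈1 β+β) (-‿cong (sym (inner-combination a c x))))

  -- The chains of the given points are combined position by position with the same weights `c`;
  -- every link survives because each `R i` is convex.
  Induced-image-convex : ∀ {n r} (R : Vector (Relation n) r) {X : Subset n} →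
    (∀ i → IsConvexRelation (R i)) → IsConvex X → IsConvex (Induced R ⟦ X ⟧)
  Induced-image-convex R R-convex X-convex (k , y , c , y∈RX , 0≤c , Σc≈1 , u≋) =
    combination c x ,
    X-convex (k , x , c , (λ l → proj₁ (proj₂ (y∈RX l))) , 0≤c , Σc≈1 , (λ _ → refl)) ,
    (λ i → combination c (λ l → z l i)) ,
    combination-cong c (λ l → proj₁ (proj₂ (chain l))) ,
    (λ j → trans (u≋ j) (combination-cong c (λ l → proj₁ (proj₂ (proj₂ (chain l)))) j)) ,
    λ i → R-convex i c _ _ 0≤c Σc≈1 (λ l → proj₂ (proj₂ (proj₂ (chain l))) i)
    where
    x = λ l → proj₁ (y∈RX l)
    chain = λ l → proj₂ (proj₂ (y∈RX l))
    z = λ l → proj₁ (chain l)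

  -- Single reflection steps.

  ϱ⋆-related : ∀ {n} (H : Halfspace n) y → reflectionRelation H (ϱ⋆ H y) y
  ϱ⋆-related H y with (H ^≤?) y
  -- Here `ϱ⋆ H y` is `y`, so the multiplier is `0#`; the upper bound amounts to twice `β - α` being
  -- nonnegative.
  ... | yes ay≤β = (0# , λ j → trans (-‿inverseʳ (y j)) (sym (zeroˡ _))) , Order.refl ,
                   0≤y-x⇒x≤y (Order.≤-respʳ-≈ shuffle (+-nonneg (0≤y-x ay≤β) (0≤y-x ay≤β)))
    where
    α = ⟨ normal H , y ⟩
    β = offset H
    +-nonneg : ∀ {p q} → 0# ≤ p → 0# ≤ q → 0# ≤ p + q
    +-nonneg 0≤p 0≤q = Order.trans 0≤p (x≤x+y _ 0≤q)
    shuffle : (β - α) + (β - α) ≈ (β + β - α) - α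
    shuffle = begin
      (β - α) + (β - α)  ≈⟨ +-assoc (β - α) β (- α) ⟨
      ((β - α) + β) - α  ≈⟨ +-congʳ (trans (+-assoc β (- α) β) (trans (+-congˡ (+-comm (- α) β)) (sym (+-assoc β β (- α))))) ⟩
      (β + β - α) - α    ∎
  -- Here `y` is the mirror image of `ϱ H y`: the direction changes sign and the upper bound holds
  -- with equality.
  ... | no ay≰β = (- t , opposite) , ax≤ay , Order.reflexive ay≈
    where
    a = normal H
    α = ⟨ a , y ⟩
    β = offset H
    t = proj₁ (ϱ-direction H y)
    opposite : y ⊖ ϱ H y ≋ (- t) • a
    opposite j = begin
      y j - ϱ H y j      ≈⟨ +-comm _ _ ⟩
      - ϱ H y j + y j    ≈⟨ +-congˡ (-‿involutive (y j)) ⟨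
      - ϱ H y j - - y j  ≈⟨ -‿+-comm (ϱ H y j) (- y j) ⟩
      - (ϱ H y j - y j)  ≈⟨ -‿cong (proj₂ (ϱ-direction H y) j) ⟩
      - (t * a j)        ≈⟨ -‿distribˡ-* t (a j) ⟩
      (- t) * a j        ∎
    β≤α : β ≤ α
    β≤α with Order.total α β
    ... | inj₁ α≤β = contradiction α≤β ay≰β
    ... | inj₂ β≤α = β≤α
    ax≤ay : ⟨ a , ϱ H y ⟩ ≤ α
    ax≤ay = ≤-cong (sym (ϱ-inner H y)) ([x+y]-x≈y α α) (+-monoˡ-≤ (- α) (+-mono-≤ β≤α β≤α))
    ay≈ : α ≈ β + β - ⟨ a , ϱ H y ⟩
    ay≈ = begin
      α                                      ≈⟨ [x+y]-x≈y (β + β - α) α ⟨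
      ((β + β - α) + α) - (β + β - α)        ≈⟨ +-congʳ (trans (+-comm _ α) (x+[y-x]≈y α (β + β))) ⟩
      β + β - (β + β - α)                    ≈⟨ +-congˡ (-‿cong (ϱ-inner H y)) ⟨
      β + β - ⟨ a , ϱ H y ⟩                  ∎

  -- Along the normal line through `x`, the value of `⟨ a , _ ⟩` determines the point. At `y` it
  -- lies between its values at `x` and at `ϱ H x`, so `y` is on the segment joining them.
  reflectionRelation-closed : ∀ {n} {X : Subset n} (H : Halfspace n) → IsConvex X →
    image (ϱ H) X ⊆ X → ∀ {x y} → x ∈ X → reflectionRelation H x y → y ∈ X
  reflectionRelation-closed H convex ϱX⊆X {x} {y} x∈X ((t , y-x≋ta) , ax≤ay , ay≤γ)
    with ratio (0≤y-x ax≤ay) (+-monoˡ-≤ (- ⟨ normal H , x ⟩) ay≤γ)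
  ... | s , 0≤s , s≤1 , u≈sδ =
    segment convex x∈X (ϱX⊆X (x , x∈X , λ _ → refl)) 0≤s s≤1 y≋
    where
    a = normal H
    α = ⟨ a , x ⟩
    N = ⟨ a , a ⟩
    ν = normSq⁻¹ H
    -- The increase of `⟨ a , _ ⟩` from `x` to `ϱ H x`; thus `(δ * ν) • a` is the displacement of
    -- the reflection.
    δ = (offset H + offset H - α) - α
    y≋x+ta : y ≋ x ⊕ t • a
    y≋x+ta j = trans (sym (x+[y-x]≈y (x j) (y j))) (+-congˡ (y-x≋ta j))
    u≈tN : ⟨ a , y ⟩ - α ≈ t * N
    u≈tN = trans (+-congʳ (trans (⟨⟩-cong a y≋x+ta) (inner-shift a x t))) ([x+y]-x≈y α (t * N))
    t≈ : t ≈ s * (δ * ν)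
    t≈ = begin
      t                      ≈⟨ *-identityʳ t ⟨
      t * 1#                 ≈⟨ *-congˡ (normSq⁻¹-inverseˡ H) ⟨
      t * (ν * N)            ≈⟨ *-congˡ (*-comm ν N) ⟩
      t * (N * ν)            ≈⟨ *-assoc t N ν ⟨
      (t * N) * ν            ≈⟨ *-congʳ u≈tN ⟨
      (⟨ a , y ⟩ - α) * ν    ≈⟨ *-congʳ u≈sδ ⟩
      (s * δ) * ν            ≈⟨ *-assoc s δ ν ⟩
      s * (δ * ν)            ∎
    y≋ : y ≋ x ⊕ s • ((δ * ν) • a)
    y≋ j = trans (y≋x+ta j) (+-congˡ (trans (*-congʳ t≈) (*-assoc s (δ * ν) (a j))))

  -- Chains of intermediate points.

  -- Entry `i` is the result of applying to `y` all maps of `f` from index `i` on, the last one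
  -- first. The chain therefore starts at `compose f y` and ends at `y`.
  trace : ∀ {n r} → Vector (Point n → Point n) r → Point n → Vector (Point n) (suc r)
  trace {r = zero}  f y _       = y
  trace {r = suc r} f y zero    = f zero (trace (f ∘ suc) y zero)
  trace {r = suc r} f y (suc i) = trace (f ∘ suc) y i

  trace-first : ∀ {n r} (f : Vector (Point n → Point n) r) y → compose f y ≡ trace f y zero
  trace-first {r = zero}  f y = _≡_.refl
  trace-first {r = suc r} f y = cong (f zero) (trace-first (f ∘ suc) y)

  trace-last : ∀ {n r} (f : Vector (Point n → Point n) r) y → y ≡ trace f y (fromℕ r)
  trace-last {r = zero}  f y = _≡_.refl
  trace-last {r = suc r} f y = trace-last (f ∘ suc) y

  -- Each entry is `f i` of its successor, which is the form of the assumption on `R i`.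
  trace-step : ∀ {n r} (R : Vector (Relation n) r) (f : Vector (Point n → Point n) r) →
    (∀ i x → R i (f i x) x) → ∀ y i → R i (trace f y (inject₁ i)) (trace f y (suc i))
  trace-step R f fxRx y zero    = fxRx zero _
  trace-step R f fxRx y (suc i) = trace-step (R ∘ suc) (f ∘ suc) (fxRx ∘ suc) y i

  compose-related : ∀ {n r} (R : Vector (Relation n) r) (f : Vector (Point n → Point n) r) →
    (∀ i x → R i (f i x) x) → ∀ y → Induced R (compose f y) y
  compose-related R f fxRx y =
    trace f y ,
    (λ j → reflexive (cong (λ x → x j) (trace-first f y))) ,
    (λ j → reflexive (cong (λ x → x j) (trace-last f y))) ,
    trace-step R f fxRx y

  -- Membership in `X` is carried along the chain one link at a time.
  chain-closed : ∀ {n r} {X : Subset n} (R : Vector (Relation n) r) →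
    (∀ i {x y} → x ∈ X → R i x y → y ∈ X) → (z : Vector (Point n) (suc r)) →
    (∀ i → R i (z (inject₁ i)) (z (suc i))) → z zero ∈ X → z (fromℕ r) ∈ X
  chain-closed {r = zero}  R closed z zRz z₀∈X = z₀∈X
  chain-closed {r = suc r} R closed z zRz z₀∈X =
    chain-closed (R ∘ suc) (closed ∘ suc) (z ∘ suc) (zRz ∘ suc) (closed zero z₀∈X (zRz zero))

theorem1 : (𝓡 : RealField) → let open Euclidean 𝓡 in
    (n r : ℕ) (H : Vector (Halfspace n) r) (P Q W : Subset n) →
    IsPolytope P → IsPolytope Q → Q ≐ conv W →
    P ⊆ Q → (∀ i → image (ϱ (H i)) Q ⊆ Q) →
    (∀ {w} → w ∈ W → compose (ϱ⋆ ∘ H) w ∈ P) →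
    Q ≐ Induced (reflectionRelation ∘ H) ⟦ P ⟧
theorem1 𝓡 n r H P Q W P-polytope Q-polytope (Q⊆convW , _) P⊆Q ϱQ⊆Q ϱ⋆W⊆P = Q⊆𝓡P , 𝓡P⊆Q
  where
  open Euclidean 𝓡
  open Reflections 𝓡
  open RealField 𝓡 using (sym)
  R = reflectionRelation ∘ H
  Q-convex : IsConvex Q
  Q-convex = polytope-convex Q-polytope

  W⊆𝓡P : W ⊆ Induced R ⟦ P ⟧
  W⊆𝓡P {w} w∈W = compose (ϱ⋆ ∘ H) w , ϱ⋆W⊆P w∈W ,
    compose-related R (ϱ⋆ ∘ H) (λ i → ϱ⋆-related (H i)) w

  Q⊆𝓡P : Q ⊆ Induced R ⟦ P ⟧
  Q⊆𝓡P q∈Q = Induced-image-convex R (λ i → reflectionRelation-convex (H i))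
    (polytope-convex P-polytope) (conv-mono {X = W} W⊆𝓡P (Q⊆convW q∈Q))

  𝓡P⊆Q : Induced R ⟦ P ⟧ ⊆ Q
  -- The ends of the chain agree with `x` and the target only up to `_≋_`; convexity of `Q` bridges
  -- both gaps.
  𝓡P⊆Q (x , x∈P , z , x≋z₀ , y≋zᵣ , zRz) = convex-resp-≋ Q-convex
    (chain-closed R (λ i → reflectionRelation-closed (H i) Q-convex (ϱQ⊆Q i)) z zRz
      (convex-resp-≋ Q-convex (P⊆Q x∈P) (λ j → sym (x≋z₀ j))))
    y≋zᵣ
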